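{- For every formula $\varphi$ of propositional linear temporal logic (LTL), the formula $\varphi\leftrightarrow\bigcirc\Box\neg\varphi$ is not provable in LTL.
   Context: Formulas of propositional linear temporal logic (LTL) are built from a set $\mathtt{Atoms}$ of propositional atoms using the Boolean connectives (conjunction $\wedge$ and negation $\neg$, with the other connectives such as $\leftrightarrow$ defined as usual) and two unary modalities: $\bigcirc$ ("next") and $\Box$ ("always", i.e. now and forever in the future). A model is a pair $\langle\mathbb{N},\Vdash\rangle$, where $\Vdash\ \subseteq\mathbb{N}\times\mathtt{Atoms}$ is an arbitrary relation, extended to all formulas by: - $n\Vdash\varphi\wedge\psi$ iff $n\Vdash\varphi$ and $n\Vdash\psi$; - $n\Vdash\neg\varphi$ iff $n\not\Vdash\varphi$; - $n\Vdash\bigcirc\varphi$ iff $(n+1)\Vdash\varphi$; - $n\Vdash\Box\varphi$ iff $m\Vdash\varphi$ for every $m\geq n$. A formula $\tau$ is valid (an LTL tautology, a law of LTL) when $n\Vdash\tau$ for every model $\langle\mathbb{N},\Vdash\rangle$ and every $n\in\mathbb{N}$. "Provable in LTL" is understood as being valid in this sense. -}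

module Defs where

open import Data.Nat.Base using (ℕ; suc; _≥_)
open import Data.Product.Base using (_×_)
open import Level using (Level; 0ℓ)
open import Relation.Binary.Core using (REL)
open import Relation.Nullary.Negation.Core using (¬_)

private
  variable
    a : Level
    Atoms : Set a

infix  8 ∼_ ○_ □_
infixr 6 _∧_
infixr 4 _⇒_
infix  3 _⇔_

data Formula (Atoms : Set a) : Set a where
  atom : Atoms → Formula Atoms
  _∧_  : Formula Atoms → Formula Atoms → Formula Atoms
  ∼_   : Formula Atoms → Formula Atoms
  ○_   : Formula Atoms → Formula Atoms
  □_   : Formula Atoms → Formula Atoms

_⇒_ : Formula Atoms → Formula Atoms → Formula Atoms
φ ⇒ ψ = ∼ (φ ∧ ∼ ψ)

_⇔_ : Formula Atoms → Formula Atoms → Formula Atoms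
φ ⇔ ψ = (φ ⇒ ψ) ∧ (ψ ⇒ φ)

-- Atomic facts are arbitrary types, not assumed decidable or ¬¬-stable.
Model : Set a → Set _
Model Atoms = REL ℕ Atoms 0ℓ

infix 2 _,_⊩_

_,_⊩_ : Model Atoms → ℕ → Formula Atoms → Set
M , n ⊩ atom p  = M n p
M , n ⊩ φ ∧ ψ   = (M , n ⊩ φ) × (M , n ⊩ ψ)
M , n ⊩ ∼ φ     = ¬ (M , n ⊩ φ)
M , n ⊩ ○ φ     = M , suc n ⊩ φ
M , n ⊩ □ φ     = ∀ m → m ≥ n → M , m ⊩ φ

Valid : {Atoms : Set a} → Formula Atoms → Set _
Valid {Atoms = Atoms} τ = (M : Model Atoms) (n : ℕ) → M , n ⊩ τ

{-# OPTIONS --safe #-}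
module Submission where

open import Data.Empty using (⊥)
open import Data.Nat.Base using (ℕ; suc; _>_)
open import Data.Nat.Properties using (≤-refl; <⇒≤)
open import Data.Product.Base using (_,_; proj₁; proj₂)
open import Level using (Level)
open import Relation.Nullary.Negation.Core using (¬_)
open import Defs

-- Yablo's paradox. If P n held, then P would fail at every m > n; failing at every
-- m > suc n forces P (suc n), which is refuted by suc n > n. So P fails
-- everywhere, which forces P 0. Every conclusion along the way is a negation, so the
-- ¬¬-forms of both implications suffice.
yablo : ∀ {p} {P : ℕ → Set p} →
        (∀ n → P n → ¬ ¬ (∀ m → m > n → ¬ P m)) →
        (∀ n → (∀ m → m > n → ¬ P m) → ¬ ¬ P n) → ⊥
yablo {P = P} fails-after holds = holds 0 (λ m _ → ¬P m) (¬P 0)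
  where
  ¬P : ∀ n → ¬ P n
  ¬P n Pn = fails-after n Pn λ ¬P-after →
    -- Both order proofs use that `m > n` unfolds to `suc n ≤ m`.
    holds (suc n) (λ m m>1+n → ¬P-after m (<⇒≤ m>1+n)) (¬P-after (suc n) ≤-refl)

theorem4p1 : {a : Level} {Atoms : Set a} (φ : Formula Atoms) → ¬ Valid (φ ⇔ ○ □ ∼ φ)
theorem4p1 {Atoms = Atoms} φ valid = yablo {P = λ n → M , n ⊩ φ}
  -- At `n`, `○ □ ∼ φ` unfolds to failure of `φ` at all `m ≥ suc n`, that is, all `m > n`. Currying
  -- `∼ (φ ∧ ∼ ψ)` gives exactly the ¬¬-form.
  (λ n φₙ ¬ψₙ → proj₁ (valid M n) (φₙ , ¬ψₙ))
  (λ n ψₙ ¬φₙ → proj₂ (valid M n) (ψₙ , ¬φₙ))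
  where
  M : Model Atoms
  -- Any valuation would do: the contradiction comes from validity at all points of a single model.
  M _ _ = ⊥
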